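{- For every formula $\phi$ of the logic $\mathrm{S1S}+\forall^{\ast}$ one can effectively construct an $\mathrm{S1S}$ formula $\psi$ that is semantically equivalent to $\phi$ (i.e. defines the same language).
   Context: $\mathrm{S1S}$ is monadic second-order logic over the structure $(\omega,<)$: formulas are built from atoms $x<y$ and $x\in X$ using $\neg$, $\vee$, first-order quantification $\forall x$ over natural numbers and second-order quantification $\forall X$ over subsets of $\omega$. Subsets of $\omega$ are identified with their characteristic $\omega$-words in $\{0,1\}^\omega$; a formula $\phi(X_1,\dots,X_n)$ whose free variables are the second-order variables $X_1,\dots,X_n$ defines the language $L(\phi)\subseteq (\{0,1\}^n)^\omega$ of tuples satisfying it (free first-order variables can be simulated by second-order variables constrained to be singletons). Two formulas are semantically equivalent if they define the same language. The logic $\mathrm{S1S}+\forall^{\ast}$ extends the syntax of $\mathrm{S1S}$ with a second-order quantifier $\forall^{\ast}X.\,\phi$, whose semantics is: a tuple $w\in(\{0,1\}^n)^\omega$ satisfies $\forall^{\ast}X.\,\phi(X,Y_1,\dots,Y_n)$ iff the set $\{w'\in\{0,1\}^\omega \mid (w',w)\text{ satisfies }\phi\}$ is comeager in the Cantor space $\{0,1\}^\omega$ (with the product topology). -}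

module Defs where

open import Level using (Level; Lift; 0ℓ) renaming (suc to lsuc)
open import Data.Bool using (Bool; true; false)
open import Data.Nat using (ℕ; zero; suc; _<_)
open import Data.Fin using (Fin)
open import Data.List using (List; []; _∷_; length)
open import Data.Vec.Functional using (Vector) renaming (_∷_ to _∷ᵛ_)
open import Data.Product using (Σ; ∃; _×_)
open import Data.Sum using (_⊎_)
open import Relation.Nullary using (¬_)
open import Relation.Binary.PropositionalEquality using (_≡_)

-- ω-words over {0,1}, identified with subsets of ω
Word : Set
Word = ℕ → Bool

-- Syntax.  Fml e m n : formulas with m free first-order variables and
-- n free second-order variables (de Bruijn indices).  The index e says
-- whether the quantifier ∀* may be used: Fml false = S1S,
-- Fml true = S1S + ∀*.
data Fml : Bool → ℕ → ℕ → Set where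
  lt     : ∀ {e m n} → Fin m → Fin m → Fml e m n
  mem    : ∀ {e m n} → Fin m → Fin n → Fml e m n
  neg    : ∀ {e m n} → Fml e m n → Fml e m n
  or     : ∀ {e m n} → Fml e m n → Fml e m n → Fml e m n
  allFO  : ∀ {e m n} → Fml e (suc m) n → Fml e m n
  allSO  : ∀ {e m n} → Fml e m (suc n) → Fml e m n
  allStar : ∀ {m n} → Fml true m (suc n) → Fml true m n

S1S : ℕ → ℕ → Set
S1S = Fml false

S1S* : ℕ → ℕ → Set
S1S* = Fml true

prefix : ℕ → Word → List Bool
prefix zero    x = []
prefix (suc k) x = x 0 ∷ prefix k (λ i → x (suc i))

-- The open set generated by a set W of finite words: the union of the
-- basic cylinders [u] for u ∈ W.  (Every open set is of this form.)
InOpen : (List Bool → Set) → Word → Set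
InOpen W x = ∃ λ k → W (prefix k x)

DenseOpen : (List Bool → Set) → Set
DenseOpen W = (u : List Bool) → Σ Word λ x → (prefix (length u) x ≡ u) × InOpen W x

Comeager : (Word → Set₁) → Set₁
Comeager S = Σ (ℕ → List Bool → Set) λ W →
  ((i : ℕ) → DenseOpen (W i)) × ((x : Word) → ((i : ℕ) → InOpen (W i) x) → S x)

Sat : ∀ {e m n} → Fml e m n → Vector ℕ m → Vector Word n → Set₁
Sat (lt i j)    ρ σ = Lift (lsuc 0ℓ) (ρ i < ρ j)
Sat (mem i X)   ρ σ = Lift (lsuc 0ℓ) (σ X (ρ i) ≡ true)
Sat (neg φ)     ρ σ = ¬ Sat φ ρ σ
Sat (or φ ψ)    ρ σ = Sat φ ρ σ ⊎ Sat ψ ρ σ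
Sat (allFO φ)   ρ σ = (k : ℕ) → Sat φ (k ∷ᵛ ρ) σ
Sat (allSO φ)   ρ σ = (w : Word) → Sat φ ρ (w ∷ᵛ σ)
Sat (allStar φ) ρ σ = Comeager (λ w → Sat φ ρ (w ∷ᵛ σ))

{-# OPTIONS --safe #-}

-- A set S is comeager in {0,1}^ω iff there are an infinite set P ⊆ ω and a
-- word z such that S contains every word which, for arbitrarily late p ∈ P,
-- agrees with z on an interval [p,q) with p < q ∈ P.  This condition
-- quantifies only over P, z, words and numbers, so replacing ∀* by it turns an
-- S1S + ∀* formula into an S1S formula.
--
-- Words agreeing with z infinitely often form a dense Gδ.  Conversely, given
-- dense open sets U₀, U₁, …, build z and P = {p₀ < p₁ < …} in stages: having
-- fixed z below pₙ, extend it to pₙ₊₁ so that, for each of the 2^pₙ words u of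
-- length pₙ, every word extending u ⌢ z[pₙ,pₙ₊₁) lies in U₀ ∩ … ∩ Uₙ.
module Submission where

open import Defs
open import Level using (Level; Lift; lift; lower; 0ℓ) renaming (suc to lsuc)
open import Axiom.ExcludedMiddle using (ExcludedMiddle)
open import Data.Bool using (Bool; true; false)
open import Data.Bool.Properties using (⇔→≡)
open import Data.Fin using (Fin; zero; suc)
open import Data.List using (List; []; _∷_; length)
open import Data.List.Properties using (∷-injective)
open import Data.Nat using (ℕ; zero; suc; _≤_; _<_; _⊔_; z≤n; s≤s; s≤s⁻¹)
open import Data.Nat.Properties
open import Data.Product using (Σ; ∃; _×_; _,_; proj₁; proj₂)
open import Data.Product.Function.NonDependent.Propositional using (_×-⇔_)
open import Data.Sum using (_⊎_; inj₁; inj₂; [_,_])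
open import Data.Sum.Function.Propositional using (_⊎-⇔_)
open import Data.Vec.Functional using (Vector) renaming (_∷_ to _∷ᵛ_)
open import Function using (_∘_; const)
open import Function.Bundles using (_⇔_; mk⇔; module Equivalence)
open import Function.Construct.Composition using (_⇔-∘_)
open import Function.Construct.Identity using (⇔-id)
open import Function.Construct.Symmetry using (⇔-sym)
open import Function.Related.TypeIsomorphisms using (→-cong-⇔; ¬-cong-⇔)
open import Relation.Binary.PropositionalEquality
  using (_≡_; refl; sym; trans; cong; cong₂; subst)
open import Relation.Nullary using (Dec; ¬_; does; yes; no; contradiction)
open import Relation.Nullary.Decidable using (dec-true; decidable-stable)

open Equivalence using (to; from)

private
  variable
    a b c d : Level
    A : Set a
    x y z u v : Word
    p q r k : ℕ

∀-cong-⇔ : {B : A → Set b} {C : A → Set c} →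
           (∀ x → B x ⇔ C x) → (∀ x → B x) ⇔ (∀ x → C x)
∀-cong-⇔ e = mk⇔ (λ f x → to (e x) (f x)) (λ f x → from (e x) (f x))

∃-cong-⇔ : {B : A → Set b} {C : A → Set c} →
           (∀ x → B x ⇔ C x) → ∃ B ⇔ ∃ C
∃-cong-⇔ e = mk⇔ (λ (x , h) → x , to (e x) h) (λ (x , h) → x , from (e x) h)

-- Words and their prefixes

Agree : Word → Word → ℕ → ℕ → Set
Agree x y p q = ∀ j → p ≤ j → j < q → x j ≡ y j

agree-sym : Agree x y p q → Agree y x p q
agree-sym h j p≤j j<q = sym (h j p≤j j<q)

agree-trans : Agree x y p q → Agree y z p q → Agree x z p q
agree-trans g h j p≤j j<q = trans (g j p≤j j<q) (h j p≤j j<q)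

agree-shrink : q ≤ r → Agree x y p r → Agree x y p q
agree-shrink q≤r h j p≤j j<q = h j p≤j (<-≤-trans j<q q≤r)

agree-join : Agree x y 0 p → Agree x y p q → Agree x y 0 q
agree-join {p = p} g h j _ j<q with <-≤-connex j p
... | inj₁ j<p = g j z≤n j<p
... | inj₂ p≤j = h j p≤j j<q

agree⇒prefix : ∀ k {x y} → Agree x y 0 k → prefix k x ≡ prefix k y
agree⇒prefix zero    h = refl
agree⇒prefix (suc k) h =
  cong₂ _∷_ (h 0 z≤n (s≤s z≤n))
            (agree⇒prefix k (λ j _ j<k → h (suc j) z≤n (s≤s j<k)))

prefix⇒agree : ∀ k {x y} → prefix k x ≡ prefix k y → Agree x y 0 k
prefix⇒agree (suc k) eq zero    _ _         = proj₁ (∷-injective eq)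
prefix⇒agree (suc k) eq (suc j) _ (s≤s j<k) =
  prefix⇒agree k (proj₂ (∷-injective eq)) j z≤n j<k

length-prefix : ∀ k x → length (prefix k x) ≡ k
length-prefix zero    x = refl
length-prefix (suc k) x = cong suc (length-prefix k (x ∘ suc))

overwrite : List Bool → Word → Word
overwrite []      z j       = z j
overwrite (b ∷ u) z zero    = b
overwrite (b ∷ u) z (suc j) = overwrite u (z ∘ suc) j

prefix-overwrite : ∀ u z → prefix (length u) (overwrite u z) ≡ u
prefix-overwrite []      z = refl
prefix-overwrite (b ∷ u) z = cong (b ∷_) (prefix-overwrite u (z ∘ suc))

overwrite-beyond : ∀ u z j → length u ≤ j → overwrite u z j ≡ z j
overwrite-beyond []      z j       _        = refl
overwrite-beyond (b ∷ u) z (suc j) (s≤s le) = overwrite-beyond u (z ∘ suc) j le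

splice : ℕ → Word → Word → Word
splice p u z = overwrite (prefix p u) z

splice-below : ∀ p u z → Agree (splice p u z) u 0 p
splice-below p u z = prefix⇒agree p
  (subst (λ l → prefix l (splice p u z) ≡ prefix p u) (length-prefix p u)
         (prefix-overwrite (prefix p u) z))

splice-above : ∀ p u z → Agree (splice p u z) z p q
splice-above p u z j p≤j _ =
  overwrite-beyond (prefix p u) z j (subst (_≤ j) (sym (length-prefix p u)) p≤j)

-- Interval characterisation of comeagerness

Infinite : Word → Set
Infinite P = ∀ k → ∃ λ p → k < p × P p ≡ true

MatchesAfter : Word → Word → Word → ℕ → Set
MatchesAfter P z x k = ∃ λ p → ∃ λ q →
  (k < p × p < q) × (P p ≡ true × P q ≡ true) × Agree x z p q

IntervalComeager : (Word → Set₁) → Set₁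
IntervalComeager S = ∃ λ P → ∃ λ z →
  Infinite P × (∀ x → (∀ k → MatchesAfter P z x k) → S x)

module _ {P z : Word} (inf : Infinite P) where

  -- A match is witnessed by a finite prefix; quantifying over all extensions of `u` spares locating
  -- it inside `u`.
  Decided : ℕ → List Bool → Set
  Decided k u = ∀ x → prefix (length u) x ≡ u → MatchesAfter P z x k

  decided-dense : ∀ k → DenseOpen (Decided k)
  -- Past `length u` the word `w` copies `z`, so the next interval between members of `P` past both
  -- bounds is a match.
  decided-dense k u with inf (k ⊔ length u)
  ... | p , k⊔l<p , Pp with inf p
  ... | q , p<q , Pq = w , prefix-overwrite u z , q , decided
    where
    w : Word
    w = overwrite u z

    decided : Decided k (prefix q w)
    decided x eq =
      p , q , (≤-<-trans (m≤m⊔n k _) k⊔l<p , p<q) , (Pp , Pq) , λ j p≤j j<q →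
        trans (prefix⇒agree q x≡w j z≤n j<q)
              (overwrite-beyond u z j
                (≤-trans (m≤n⊔m k _) (≤-trans (<⇒≤ k⊔l<p) p≤j)))
      where
      x≡w : prefix q x ≡ prefix q w
      x≡w = subst (λ l → prefix l x ≡ prefix q w) (length-prefix q w) eq

  decided-sound : ∀ k x → InOpen (Decided k) x → MatchesAfter P z x k
  decided-sound k x (n , d) =
    d x (cong (λ l → prefix l x) (length-prefix n x))

intervalComeager⇒comeager : {S : Word → Set₁} → IntervalComeager S → Comeager S
intervalComeager⇒comeager (P , z , inf , S-matches) =
  Decided {z = z} inf , decided-dense inf ,
  λ x x∈W → S-matches x (λ k → decided-sound inf k x (x∈W k))

-- A condition (q , z) stands for the finite word z[0,q).
Condition : Set
Condition = ℕ × Word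

_⊑_ : Condition → Condition → Set
(q , z) ⊑ (q′ , z′) = q ≤ q′ × Agree z z′ 0 q

⊑-refl : ∀ {c} → c ⊑ c
⊑-refl = ≤-refl , λ _ _ _ → refl

⊑-trans : ∀ {c d e} → c ⊑ d → d ⊑ e → c ⊑ e
⊑-trans (q≤r , g) (r≤s , h) = ≤-trans q≤r r≤s , agree-trans g (agree-shrink q≤r h)

-- `persist` lets several requirements be met one after another. The bound `p` is there because
-- `Forces` replaces the first `p` letters, which must be settled beforehand.
record DenseAbove (p : ℕ) (Q : Condition → Set) : Set where
  field
    persist : ∀ {c d} → c ⊑ d → Q c → Q d
    attain  : ∀ c → p ≤ proj₁ c → ∃ λ d → c ⊑ d × Q d

open DenseAbove

densePair : {Q R : Condition → Set} → DenseAbove p Q → DenseAbove p R →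
            DenseAbove p (λ c → Q c × R c)
densePair f g .persist c⊑d (Qc , Rc) = persist f c⊑d Qc , persist g c⊑d Rc
densePair f g .attain c p≤c with attain f c p≤c
... | d , c⊑d , Qd with attain g d (≤-trans p≤c (proj₁ c⊑d))
... | e , d⊑e , Re = e , ⊑-trans c⊑d d⊑e , persist f d⊑e Qd , Re

denseMap : {Q R : Condition → Set} → (∀ {c} → Q c → R c) → (∀ {c} → R c → Q c) →
           DenseAbove p Q → DenseAbove p R
denseMap h h⁻¹ f .persist c⊑d Rc = h (persist f c⊑d (h⁻¹ Rc))
denseMap h h⁻¹ f .attain c p≤c with attain f c p≤c
... | d , c⊑d , Qd = d , c⊑d , h Qd

denseBelow : {Q : ℕ → Condition → Set} → (∀ i → DenseAbove p (Q i)) →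
             ∀ n → DenseAbove p (λ c → ∀ i → i < n → Q i c)
denseBelow f zero .persist _ _ i ()
denseBelow f zero .attain c _ = c , ⊑-refl , λ i ()
denseBelow {Q = Q} f (suc n) =
  denseMap merge (λ h → (λ i i<n → h i (m<n⇒m<1+n i<n)) , h n ≤-refl)
           (densePair (denseBelow f n) (f n))
  where
  merge : ∀ {c} → (∀ i → i < n → Q i c) × Q n c → ∀ i → i < suc n → Q i c
  merge (h , Qn) i i<1+n with m≤n⇒m<n∨m≡n (s≤s⁻¹ i<1+n)
  ... | inj₁ i<n  = h i i<n
  ... | inj₂ refl = Qn

_∷ʷ_ : Bool → Word → Word
(b ∷ʷ u) zero    = b
(b ∷ʷ u) (suc j) = u j

agree-∷ʷ : ∀ b → Agree u v 0 k → Agree (b ∷ʷ u) (b ∷ʷ v) 0 (suc k)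
agree-∷ʷ b h zero    _ _         = refl
agree-∷ʷ b h (suc j) _ (s≤s j<k) = h j z≤n j<k

-- Only the 2^l prefixes of u matter, so this is a finite intersection.
denseWords : ∀ l {Q : Word → Condition → Set} →
             (∀ {u v c} → Agree u v 0 l → Q u c → Q v c) →
             (∀ u → DenseAbove p (Q u)) → DenseAbove p (λ c → ∀ u → Q u c)
denseWords zero resp f =
  -- At length 0 all words agree, so `const false` represents every `u`.
  denseMap (λ Qc u → resp (λ _ _ ()) Qc) (λ h → h (const false)) (f (const false))
-- Both choices of the first letter are absorbed into one property of the tail, which depends on `l`
-- letters only.
denseWords (suc l) {Q} resp f =
  denseMap split (λ h u → h (false ∷ʷ u) , h (true ∷ʷ u))
    (denseWords l
      (λ u~v (h₀ , h₁) → resp (agree-∷ʷ false u~v) h₀ , resp (agree-∷ʷ true u~v) h₁)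
      (λ u → densePair (f (false ∷ʷ u)) (f (true ∷ʷ u))))
  where
  -- Head and tail give back a word only pointwise; `resp` turns this agreement into a transfer of
  -- `Q`.
  η : ∀ u {b} → b ≡ u 0 → Agree (b ∷ʷ (u ∘ suc)) u 0 (suc l)
  η u eq zero    _ _ = eq
  η u eq (suc j) _ _ = refl

  split : ∀ {c} → (∀ u → Q (false ∷ʷ u) c × Q (true ∷ʷ u) c) → ∀ u → Q u c
  split h u with u 0 in eq
  ... | false = resp (η u (sym eq)) (proj₁ (h (u ∘ suc)))
  ... | true  = resp (η u (sym eq)) (proj₂ (h (u ∘ suc)))

-- The block `z[p,q)` has to work after a foreign beginning `u`, since a word that matches `z` late
-- may differ from it earlier.
Forces : (List Bool → Set) → ℕ → Word → Condition → Set
Forces W p u (q , z) = ∀ x → Agree x u 0 p → Agree x z p q → InOpen W x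

forces-resp : ∀ {W c} → Agree u v 0 p → Forces W p u c → Forces W p v c
forces-resp u~v h x x~v = h x (agree-trans x~v (agree-sym u~v))

-- To attain: put `u` in place of the beginning of `z`, extend into `W` by density, then restore the
-- old beginning of `z`.
forces-dense : ∀ {W} → DenseOpen W → ∀ p u → DenseAbove p (Forces W p u)
forces-dense dense p u .persist (q≤q′ , z~z′) h x x~u x~z′ =
  h x x~u (agree-trans (agree-shrink q≤q′ x~z′) (λ j _ → agree-sym z~z′ j z≤n))
forces-dense {W} dense p u .attain (q , z) p≤q with dense (prefix q (splice p u z))
-- The prefix of length `k` puts `x` into the open set; `q` keeps the new condition an extension of
-- the old one.
... | x , x≡s , k , Wx = (q ⊔ k , z′) , (m≤m⊔n q k , z~z′) , forced
  where
  s z′ : Word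
  s  = splice p u z
  z′ = splice p z x

  x~s : Agree x s 0 q
  x~s = prefix⇒agree q
    (subst (λ l → prefix l x ≡ prefix q s) (length-prefix q s) x≡s)

  z~z′ : Agree z z′ 0 q
  z~z′ = agree-join (agree-sym (splice-below p z x)) λ j p≤j j<q →
    sym (trans (splice-above p z x j p≤j j<q)
        (trans (x~s j z≤n j<q) (splice-above p u z j p≤j j<q)))

  forced : Forces W p u (q ⊔ k , z′)
  forced w w~u w~z′ = k , subst W (sym (agree⇒prefix k w~x)) Wx
    where
    w~x : Agree w x 0 k
    w~x = agree-shrink (m≤n⊔m q k) (agree-join
      (agree-trans w~u (agree-sym
        (agree-trans (agree-shrink p≤q x~s) (splice-below p u z))))
      (agree-trans w~z′ (splice-above p z x)))

-- Building `P` and `z` from a sequence of dense open sets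

module Construction (W : ℕ → List Bool → Set) (dense : ∀ i → DenseOpen (W i)) where

  Stage : ℕ → ℕ → Condition → Set
  Stage n p c = ∀ u i → i < suc n → Forces (W i) p u c

  stage-dense : ∀ n p → DenseAbove p (Stage n p)
  stage-dense n p = denseWords p (λ {_} {_} {c} u~v h i i<n → forces-resp {W = W i} {c} u~v (h i i<n))
    (λ u → denseBelow (λ i → forces-dense {W i} (dense i) p u) (suc n))

  next : ∀ n ((p , z) : Condition) → ∃ λ d → (suc p , z) ⊑ d × Stage n p d
  -- Starting from `suc p` instead of `p` makes the positions strictly increasing.
  next n (p , z) = attain (stage-dense n p) (suc p , z) (n≤1+n p)

  chain : ℕ → Condition
  chain zero    = 0 , const false
  chain (suc n) = proj₁ (next n (chain n))

  pos : ℕ → ℕ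
  pos n = proj₁ (chain n)

  word : ℕ → Word
  word n = proj₂ (chain n)

  pos-suc : ∀ n → pos n < pos (suc n)
  pos-suc n = proj₁ (proj₁ (proj₂ (next n (chain n))))

  chain-suc : ∀ n → chain n ⊑ chain (suc n)
  chain-suc n =
    <⇒≤ (pos-suc n) , agree-shrink (n≤1+n _) (proj₂ (proj₁ (proj₂ (next n (chain n)))))

  chain-forces : ∀ n → Stage n (pos n) (chain (suc n))
  chain-forces n = proj₂ (proj₂ (next n (chain n)))

  chain-mono : ∀ {m n} → m ≤ n → chain m ⊑ chain n
  chain-mono {m} {zero}  z≤n = ⊑-refl
  chain-mono {m} {suc n} m≤1+n with m≤n⇒m<n∨m≡n m≤1+n
  ... | inj₁ m<1+n = ⊑-trans (chain-mono (s≤s⁻¹ m<1+n)) (chain-suc n)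
  ... | inj₂ refl  = ⊑-refl

  pos-cancel-< : ∀ m n → pos m < pos n → m < n
  pos-cancel-< m n pm<pn = ≰⇒> (λ n≤m → <⇒≱ pm<pn (proj₁ (chain-mono n≤m)))

  n≤pos : ∀ n → n ≤ pos n
  n≤pos zero    = z≤n
  n≤pos (suc n) = ≤-<-trans (n≤pos n) (pos-suc n)

  -- Stage `suc j` has settled letter `j`, because `suc j ≤ pos (suc j)`.
  limit : Word
  limit j = word (suc j) j

  limit-agree : ∀ n → Agree limit (word n) 0 (pos n)
  limit-agree n j _ j<pos with ≤-total (suc j) n
  ... | inj₁ j<n = proj₂ (chain-mono j<n) j z≤n (n≤pos (suc j))
  ... | inj₂ n≤j = sym (proj₂ (chain-mono n≤j) j z≤n j<pos)

  -- The bound makes the search finite and loses nothing, as `n ≤ pos n`.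
  position? : ∀ j → Dec (∃ λ n → n < suc j × pos n ≡ j)
  position? j = anyUpTo? (λ n → pos n ≟ j) (suc j)

  positions : Word
  positions j = does (position? j)

  positions-pos : ∀ n → positions (pos n) ≡ true
  positions-pos n = dec-true (position? (pos n)) (n , s≤s (n≤pos n) , refl)

  positions-inv : ∀ j → positions j ≡ true → ∃ λ n → pos n ≡ j
  positions-inv j eq with position? j
  ... | yes (n , _ , e) = n , e
  positions-inv j () | no _

  positions-infinite : Infinite positions
  positions-infinite k =
    pos (suc k) , ≤-<-trans (n≤pos k) (pos-suc k) , positions-pos (suc k)

  -- A match past `pos i` runs from some `pos n` to some `pos m` with `i < n < m`, so it covers the
  -- whole block built at stage `n`. That block forces `W i` after every beginning.
  matches⇒inOpen : ∀ x → (∀ k → MatchesAfter positions limit x k) → ∀ i → InOpen (W i) x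
  matches⇒inOpen x match i with match (pos i)
  ... | p , q , (i<p , p<q) , (Pp , Pq) , x~z
    with positions-inv p Pp | positions-inv q Pq
  ... | n , refl | m , refl =
    -- The beginning `u` is taken to be that of `x` itself.
    chain-forces n x i (m<n⇒m<1+n (pos-cancel-< i n i<p)) x (λ _ _ _ → refl)
      (agree-trans (agree-shrink (proj₁ (chain-mono (pos-cancel-< n m p<q))) x~z)
                   (λ j _ → limit-agree (suc n) j z≤n))

comeager⇒intervalComeager : {S : Word → Set₁} → Comeager S → IntervalComeager S
comeager⇒intervalComeager (W , dense , sub) =
  positions , limit , positions-infinite , λ x m → sub x (matches⇒inOpen x m)
  where open Construction W dense

comeager⇔intervalComeager : {S : Word → Set₁} → Comeager S ⇔ IntervalComeager S
comeager⇔intervalComeager = mk⇔ comeager⇒intervalComeager intervalComeager⇒comeager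

-- Renaming of second-order variables

liftRen : ∀ {n n′} → (Fin n → Fin n′) → Fin (suc n) → Fin (suc n′)
liftRen f zero    = zero
liftRen f (suc i) = suc (f i)

rename : ∀ {m n n′} → (Fin n → Fin n′) → S1S m n → S1S m n′
rename f (lt i j)  = lt i j
rename f (mem i X) = mem i (f X)
rename f (neg φ)   = neg (rename f φ)
rename f (or φ ψ)  = or (rename f φ) (rename f ψ)
rename f (allFO φ) = allFO (rename f φ)
rename f (allSO φ) = allSO (rename (liftRen f) φ)

-- Environments are compared letter by letter, which is all that `mem` inspects and is preserved
-- under binders.
sat-rename : ∀ {m n n′} (f : Fin n → Fin n′) (φ : S1S m n) {ρ : Vector ℕ m}
             {σ : Vector Word n} {σ′ : Vector Word n′} →
             (∀ X j → σ X j ≡ σ′ (f X) j) →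
             Sat φ ρ σ ⇔ Sat (rename f φ) ρ σ′
sat-rename f (lt i j)  e = ⇔-id _
sat-rename f (mem i X) {ρ} e =
  mk⇔ (λ (lift h) → lift (trans (sym (e X (ρ i))) h))
      (λ (lift h) → lift (trans (e X (ρ i)) h))
sat-rename f (neg φ)   e = ¬-cong-⇔ (sat-rename f φ e)
sat-rename f (or φ ψ)  e = sat-rename f φ e ⊎-⇔ sat-rename f ψ e
sat-rename f (allFO φ) e = ∀-cong-⇔ (λ _ → sat-rename f φ e)
sat-rename f (allSO φ) e = ∀-cong-⇔ (λ w → sat-rename (liftRen f) φ
  λ { zero j → refl ; (suc X) j → e X j })

-- The translation

and imp iff : ∀ {m n} → S1S m n → S1S m n → S1S m n
and φ ψ = neg (or (neg φ) (neg ψ))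
imp φ ψ = or (neg φ) ψ
iff φ ψ = and (imp φ ψ) (imp ψ φ)

exFO : ∀ {m n} → S1S (suc m) n → S1S m n
exFO φ = neg (allFO (neg φ))

exSO : ∀ {m n} → S1S m (suc n) → S1S m n
exSO φ = neg (allSO (neg φ))

infinite : ∀ {m n} → Fin n → S1S m n
infinite P = allFO (exFO (and (lt (suc zero) zero) (mem zero P)))

agree : ∀ {m n} → Fin n → Fin n → Fin m → Fin m → S1S m n
agree X Z p q = allFO
  -- With `<` as the only order atom, `p ≤ j` is written as the negation of `j < p`.
  (imp (neg (lt zero (suc p))) (imp (lt zero (suc q)) (iff (mem zero X) (mem zero Z))))

matches : ∀ {m n} → Fin n → Fin n → Fin n → S1S m n
matches P Z X = allFO (exFO (exFO (and
  (and (lt (suc (suc zero)) (suc zero)) (lt (suc zero) zero))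
  (and (and (mem (suc zero) P) (mem zero P)) (agree X Z (suc zero) zero)))))

-- Makes room for z and P, which are bound outside X.
keepHead : ∀ {n} → Fin (suc n) → Fin (suc (suc (suc n)))
keepHead zero    = zero
keepHead (suc i) = suc (suc (suc i))

comeagerly : ∀ {m n} → S1S m (suc n) → S1S m n
-- `P` is bound outermost, then `z`, then `x`: `P` has index 1 in `infinite` and index 2 below the
-- universal quantifier.
comeagerly φ = exSO (exSO (and (infinite (suc zero))
  (allSO (imp (matches (suc (suc zero)) (suc zero) zero) (rename keepHead φ)))))

-- Plain structural recursion with no appeal to excluded middle: this is the effectiveness of the
-- construction.
translate : ∀ {e m n} → Fml e m n → S1S m n
translate (lt i j)    = lt i j
translate (mem i X)   = mem i X
translate (neg φ)     = neg (translate φ)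
translate (or φ ψ)    = or (translate φ) (translate ψ)
translate (allFO φ)   = allFO (translate φ)
translate (allSO φ)   = allSO (translate φ)
translate (allStar φ) = comeagerly (translate φ)

-- Classical correctness of the translation

module Correctness (em : ExcludedMiddle (lsuc 0ℓ)) where

  stable : {A : Set₁} → ¬ ¬ A → A
  stable = decidable-stable em

  -- Decodes the defined existential quantifier. The built-in congruence lets `C` live in a lower
  -- universe than `Sat`, as `Infinite` and `Agree` do.
  ¬∀¬⇔∃ : {A : Set} {B : A → Set₁} {C : A → Set c} → (∀ x → B x ⇔ C x) →
          (¬ (∀ x → ¬ B x)) ⇔ ∃ C
  ¬∀¬⇔∃ e = ∃-cong-⇔ e ⇔-∘ mk⇔
    (λ h → stable (λ ¬∃ → h (λ x Bx → ¬∃ (x , Bx))))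
    (λ (x , Bx) h → h x Bx)

  ¬[¬⊎¬]⇔× : {A B : Set₁} {C : Set c} {D : Set d} → A ⇔ C → B ⇔ D →
             (¬ (¬ A ⊎ ¬ B)) ⇔ (C × D)
  ¬[¬⊎¬]⇔× e f = (e ×-⇔ f) ⇔-∘ mk⇔
    (λ h → stable (h ∘ inj₁) , stable (h ∘ inj₂))
    (λ (a , b) → [ (λ ¬a → ¬a a) , (λ ¬b → ¬b b) ])

  ¬⊎⇔→ : {A B : Set₁} {C : Set c} {D : Set d} → A ⇔ C → B ⇔ D →
         (¬ A ⊎ B) ⇔ (C → D)
  ¬⊎⇔→ {A = A} {B} e f = →-cong-⇔ e f ⇔-∘ mk⇔
    [ (λ ¬a a → contradiction a ¬a) , const ] classical
    where
    classical : (A → B) → ¬ A ⊎ B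
    classical g with em {A}
    ... | yes a = inj₂ (g a)
    ... | no ¬a = inj₁ ¬a

  lift-⇔ : {A : Set} → Lift (lsuc 0ℓ) A ⇔ A
  lift-⇔ = mk⇔ lower lift

  sat-iff-mem : ∀ {m n} {ρ : Vector ℕ m} {σ : Vector Word n} i X Z →
                Sat (iff (mem i X) (mem i Z)) ρ σ ⇔ (σ X (ρ i) ≡ σ Z (ρ i))
  sat-iff-mem i X Z =
    -- Two Booleans are equal once each is `true` whenever the other is.
    mk⇔ (λ (f , g) → ⇔→≡ (mk⇔ f g)) (λ eq → trans (sym eq) , trans eq)
    ⇔-∘ ¬[¬⊎¬]⇔× (¬⊎⇔→ lift-⇔ lift-⇔) (¬⊎⇔→ lift-⇔ lift-⇔)

  sat-infinite : ∀ {m n} {ρ : Vector ℕ m} {σ : Vector Word n} P →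
                 Sat (infinite P) ρ σ ⇔ Infinite (σ P)
  sat-infinite P = ∀-cong-⇔ λ k → ¬∀¬⇔∃ λ p → ¬[¬⊎¬]⇔× lift-⇔ lift-⇔

  sat-agree : ∀ {m n} {ρ : Vector ℕ m} {σ : Vector Word n} X Z p q →
              Sat (agree X Z p q) ρ σ ⇔ Agree (σ X) (σ Z) (ρ p) (ρ q)
  sat-agree {ρ = ρ} {σ} X Z p q = ∀-cong-⇔ λ j →
    ¬⊎⇔→ (mk⇔ (λ h → ≮⇒≥ (h ∘ lift)) (λ le → ≤⇒≯ le ∘ lower))
      (¬⊎⇔→ lift-⇔ (sat-iff-mem {ρ = j ∷ᵛ ρ} {σ} zero X Z))

  sat-matches : ∀ {m n} {ρ : Vector ℕ m} {σ : Vector Word n} P Z X →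
                Sat (matches P Z X) ρ σ ⇔ (∀ k → MatchesAfter (σ P) (σ Z) (σ X) k)
  sat-matches {ρ = ρ} {σ} P Z X = ∀-cong-⇔ λ k → ¬∀¬⇔∃ λ p → ¬∀¬⇔∃ λ q →
    ¬[¬⊎¬]⇔× (¬[¬⊎¬]⇔× lift-⇔ lift-⇔)
      (¬[¬⊎¬]⇔× (¬[¬⊎¬]⇔× lift-⇔ lift-⇔)
        (sat-agree {ρ = q ∷ᵛ p ∷ᵛ k ∷ᵛ ρ} {σ} X Z (suc zero) zero))

  -- `S` is left abstract so that it can be the satisfaction set of the original formula, with `e`
  -- supplied by the induction hypothesis.
  sat-comeagerly : ∀ {m n} {ρ : Vector ℕ m} {σ : Vector Word n} (φ : S1S m (suc n))
                   {S : Word → Set₁} → (∀ x → Sat φ ρ (x ∷ᵛ σ) ⇔ S x) →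
                   Sat (comeagerly φ) ρ σ ⇔ IntervalComeager S
  sat-comeagerly {ρ = ρ} {σ} φ e = ¬∀¬⇔∃ λ P → ¬∀¬⇔∃ λ z →
    ¬[¬⊎¬]⇔× (sat-infinite {ρ = ρ} {z ∷ᵛ P ∷ᵛ σ} (suc zero)) (∀-cong-⇔ λ x →
      ¬⊎⇔→ (sat-matches {ρ = ρ} {x ∷ᵛ z ∷ᵛ P ∷ᵛ σ} (suc (suc zero)) (suc zero) zero)
        (e x ⇔-∘ ⇔-sym (sat-rename keepHead φ λ { zero j → refl ; (suc X) j → refl })))

  translate-correct : ∀ {e m n} (φ : Fml e m n) {ρ : Vector ℕ m} {σ : Vector Word n} →
                      Sat φ ρ σ ⇔ Sat (translate φ) ρ σ
  translate-correct (lt i j)    = ⇔-id _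
  translate-correct (mem i X)   = ⇔-id _
  translate-correct (neg φ)     = ¬-cong-⇔ (translate-correct φ)
  translate-correct (or φ ψ)    = translate-correct φ ⊎-⇔ translate-correct ψ
  translate-correct (allFO φ)   = ∀-cong-⇔ λ _ → translate-correct φ
  translate-correct (allSO φ)   = ∀-cong-⇔ λ _ → translate-correct φ
  translate-correct (allStar φ) =
    -- `Comeager` is first exchanged for the interval condition on the same set; only then is the
    -- formula translated.
    ⇔-sym (sat-comeagerly (translate φ) λ _ → ⇔-sym (translate-correct φ))
    ⇔-∘ comeager⇔intervalComeager

theorem4p1 : Σ ((m n : ℕ) → S1S* m n → S1S m n) λ t →
    ExcludedMiddle (lsuc 0ℓ) →
    (m n : ℕ) (φ : S1S* m n) (ρ : Vector ℕ m) (σ : Vector Word n) →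
    Sat φ ρ σ ⇔ Sat (t m n φ) ρ σ
theorem4p1 = (λ m n → translate) , λ em m n φ ρ σ → Correctness.translate-correct em φ
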